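{- For each $n\geq 2$, $$\max_{\equiv}\ \max_{w\in S_n}\ \lvert D_R(\mathbf S_\equiv(w))\rvert=n-2,$$ where the first maximum is over all essential semilattice congruences $\equiv$ on the left weak order of the symmetric group $S_n$.
   Context: $S_n$ is the symmetric group, with simple generators $s_i=(i\;\,i+1)$, $1\le i\le n-1$; products are compositions of functions and $\ell$ is Coxeter length. The left weak order is $x\leq_L y \iff \ell(yx^{ -1})=\ell(y)-\ell(x)$; $x\wedge y$ denotes the meet in this order. The right descent set is $D_R(w)=\{s_i:\ell(ws_i)<\ell(w)\}=\{s_i: w(i)>w(i+1)\}$. A semilattice congruence on a meet-semilattice is an equivalence relation $\equiv$ such that $x_1\equiv x_2$ and $y_1\equiv y_2$ imply $x_1\wedge y_1\equiv x_2\wedge y_2$. It is essential (on $(S_n,\leq_L)$) if the identity $e$ forms a singleton congruence class. Every congruence class has a unique minimal element; $\pi_\downarrow^\equiv(w)$ denotes the minimal element of the class of $w$. The Coxeter stack-sorting operator is $\mathbf S_\equiv:S_n\to S_n$, $\mathbf S_\equiv(w)=w\,(\pi_\downarrow^\equiv(w))^{ -1}$. -}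

module Defs where

open import Level using (Level; 0ℓ)
open import Data.Nat.Base using (ℕ; zero; suc; pred; _≤_; _<_; z≤n; s≤s)
open import Data.Nat.Properties using (_<?_)
open import Data.Integer.Base using (+_; _-_)
open import Data.Fin.Base using (Fin; zero; suc; inject₁)
open import Data.Fin.Properties using (_≟_; all?; any?)
open import Data.Fin.Induction using (<-weakInduction)
open import Data.Fin.Permutation
  using (Permutation′; _⟨$⟩ʳ_; _≈_; id; flip; _∘ₚ_; transpose; lift₀; remove;
         lift₀-remove; lift₀-transpose)
open import Data.Fin.Permutation.Components using (transpose-inverse)
open import Data.Fin.Subset using (Subset; ∣_∣)
open import Data.Vec.Base using (Vec; []; _∷_; tabulate; foldr′)
open import Data.Product.Base using (∃; Σ-syntax; ∃-syntax; _×_; _,_; proj₁; proj₂)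
open import Relation.Unary using (Pred; Decidable)
open import Relation.Binary.Core using (Rel; _⇒_)
open import Relation.Binary.Structures using (IsEquivalence)
open import Relation.Nullary using (Dec; yes; no; contradiction)
open import Relation.Nullary.Decidable using (⌊_⌋; map′; dec-true; dec-false)
open import Relation.Binary.PropositionalEquality.Core
  using (_≡_; refl; sym; trans; cong)

private
  variable
    n : ℕ
    a : Level

infixl 7 _·_
infix  8 _⁻¹
infix  4 _≤ᴸ_

-- Permutations are compared with the pointwise equality _≈_ throughout.
S : ℕ → Set
S = Permutation′

e : S n
e = id

-- Composition of functions, (x · y)(i) = x (y (i)); the library's _∘ₚ_
-- composes in the opposite order.
_·_ : S n → S n → S n
x · y = y ∘ₚ x

_⁻¹ : S n → S n
_⁻¹ = flip

-- Positions are counted from 0, so the n − 1 simple generators of S n are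
-- indexed by Fin (pred n), and s i exchanges the positions i and i + 1.
s : Fin (pred n) → S n
s {n = suc _} i = transpose (inject₁ i) (suc i)

Word : ℕ → ℕ → Set
Word n k = Vec (Fin (pred n)) k

⟦_⟧ : ∀ {k} → Word n k → S n
⟦_⟧ = foldr′ (λ i w → s i · w) e

HasWord : S n → ℕ → Set
HasWord {n} w k = Σ[ u ∈ Word n k ] ⟦ u ⟧ ≈ w

private
  searchVec : ∀ {m} k {P : Vec (Fin m) k → Set} →
              (∀ u → Dec (P u)) → Dec (∃ P)
  searchVec zero    P? = map′ ([] ,_) (λ { ([] , p) → p }) (P? [])
  searchVec (suc k) P? =
    map′ (λ { (i , u , p) → i ∷ u , p }) (λ { (i ∷ u , p) → i , u , p })
         (any? λ i → searchVec k λ u → P? (i ∷ u))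

  least : ∀ {P : Pred ℕ 0ℓ} → Decidable P → ∀ k → P k →
          ∃[ m ] P m × (∀ j → P j → m ≤ j)
  least P? k pk with P? 0
  ... | yes p0 = 0 , p0 , λ _ _ → z≤n
  least P? zero    pk | no ¬p0 = contradiction pk ¬p0
  least P? (suc k) pk | no ¬p0 with least (λ j → P? (suc j)) k pk
  ... | m , pm , min = suc m , pm , λ { zero    p0 → contradiction p0 ¬p0
                                      ; (suc j) pj → s≤s (min j pj) }

  hasWord? : (w : S n) → Decidable (HasWord w)
  hasWord? w k = searchVec k λ u → all? λ i → (⟦ u ⟧ ⟨$⟩ʳ i) ≟ (w ⟨$⟩ʳ i)

  transpose-sym : (i j k : Fin n) →
                  transpose i j ⟨$⟩ʳ k ≡ transpose j i ⟨$⟩ʳ k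
  transpose-sym i j k with k ≟ i | k ≟ j
  ... | yes k≡i | yes k≡j = trans (sym k≡j) k≡i
  ... | yes k≡i | no _    rewrite dec-true (k ≟ i) k≡i = refl
  ... | no _    | yes k≡j rewrite dec-true (k ≟ j) k≡j = refl
  ... | no k≢i  | no k≢j  rewrite dec-false (k ≟ i) k≢i | dec-false (k ≟ j) k≢j = refl

  s-involutive : ∀ {n} (i : Fin n) → s {suc n} i · s i ≈ e
  s-involutive i k =
    trans (transpose-sym (inject₁ i) (suc i) (s i ⟨$⟩ʳ k))
          (transpose-inverse (suc i) (inject₁ i) {k})

  s-suc-hits : ∀ {n} (i : Fin n) → s {suc n} i ⟨$⟩ʳ suc i ≡ inject₁ i
  s-suc-hits i = trans (transpose-sym (inject₁ i) (suc i) (suc i))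
                       (transpose-matchˡ (suc i) (inject₁ i))
    where
    transpose-matchˡ : (i j : Fin n) → transpose i j ⟨$⟩ʳ i ≡ j
    transpose-matchˡ i j with i ≟ i
    ... | yes _  = refl
    ... | no i≢i = contradiction refl i≢i

  lift-word : ∀ {n k} (u : Word (suc n) k) →
              Σ[ u′ ∈ Word (suc (suc n)) k ] ⟦ u′ ⟧ ≈ lift₀ ⟦ u ⟧
  lift-word [] = [] , λ { zero → refl ; (suc _) → refl }
  lift-word (i ∷ u) with lift-word u
  ... | u′ , eq = suc i ∷ u′ , λ k →
    trans (cong (s (suc i) ⟨$⟩ʳ_) (eq k))
          (trans (lift₀-transpose (inject₁ i) (suc i) (lift₀ ⟦ u ⟧ ⟨$⟩ʳ k))
                 (lift₀-∘ k))
    where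
    lift₀-∘ : ∀ k → lift₀ (s i) ⟨$⟩ʳ (lift₀ ⟦ u ⟧ ⟨$⟩ʳ k) ≡ lift₀ (s i · ⟦ u ⟧) ⟨$⟩ʳ k
    lift₀-∘ zero    = refl
    lift₀-∘ (suc _) = refl

generated : (w : S n) → ∃ (HasWord w)
generated {zero}  w = 0 , [] , λ ()
generated {suc n} w = <-weakInduction P base step (w ⟨$⟩ʳ zero) w refl
  where
  P : Fin (suc n) → Set
  P j = (w : S (suc n)) → w ⟨$⟩ʳ zero ≡ j → ∃ (HasWord w)

  fixes-zero : ∀ {n} (w : S (suc n)) → (∀ (v : S n) → ∃ (HasWord v)) →
               w ⟨$⟩ʳ zero ≡ zero → ∃ (HasWord w)
  fixes-zero {zero}  w _   w0≡0 = 0 , [] , λ { zero → sym w0≡0 }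
  fixes-zero {suc n} w gen w0≡0 with gen (remove zero w)
  ... | k , u , u≈ with lift-word u
  ...   | u′ , u′≈ = k , u′ , λ i →
    trans (u′≈ i) (trans (lifted i) (lift₀-remove w w0≡0 i))
    where
    lifted : lift₀ ⟦ u ⟧ ≈ lift₀ (remove zero w)
    lifted zero    = refl
    lifted (suc i) = cong suc (u≈ i)

  base : P zero
  base w = fixes-zero w generated

  step : ∀ j → P (inject₁ j) → P (suc j)
  step j ih w w0≡ with ih (s j · w) (trans (cong (s j ⟨$⟩ʳ_) w0≡) (s-suc-hits j))
  ... | k , u , u≈ = suc k , j ∷ u , λ i →
    trans (cong (s j ⟨$⟩ʳ_) (u≈ i)) (s-involutive j (w ⟨$⟩ʳ i))

private
  shortest : (w : S n) → ∃[ m ] HasWord w m × (∀ k → HasWord w k → m ≤ k)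
  shortest w = least (hasWord? w) (proj₁ (generated w)) (proj₂ (generated w))

-- Coxeter length: the least length of a word in the simple generators.
-- Abstract, so that it is used only through ℓ-word and ℓ-least, which
-- characterise it.
abstract
  ℓ : S n → ℕ
  ℓ w = proj₁ (shortest w)

  ℓ-word : (w : S n) → HasWord w (ℓ w)
  ℓ-word w = proj₁ (proj₂ (shortest w))

  ℓ-least : (w : S n) → ∀ k → HasWord w k → ℓ w ≤ k
  ℓ-least w = proj₂ (proj₂ (shortest w))

-- The subtraction is that of ℤ, not truncated.
_≤ᴸ_ : Rel (S n) 0ℓ
x ≤ᴸ y = + ℓ (y · x ⁻¹) ≡ + ℓ y - + ℓ x

-- The i-th entry records whether s i is a right descent.
D_R : S n → Subset (pred n)
D_R w = tabulate λ i → ⌊ ℓ (w · s i) <? ℓ w ⌋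

IsMeet : S n → S n → S n → Set
IsMeet x y m = m ≤ᴸ x × m ≤ᴸ y × (∀ z → z ≤ᴸ x → z ≤ᴸ y → z ≤ᴸ m)

-- Meets are given by their universal property, hence the quantification over
-- all m₁, m₂ that are meets of the respective pairs. The field ≈⇒~ says that
-- _~_ is a relation on permutations and not on their representations.
record IsSemilatticeCongruence (_~_ : Rel (S n) 0ℓ) : Set where
  field
    isEquivalence : IsEquivalence _~_
    ≈⇒~           : _≈_ ⇒ _~_
    ∧-cong        : ∀ {x₁ x₂ y₁ y₂ m₁ m₂} → x₁ ~ x₂ → y₁ ~ y₂ →
                    IsMeet x₁ y₁ m₁ → IsMeet x₂ y₂ m₂ → m₁ ~ m₂

IsEssential : Rel (S n) 0ℓ → Set
IsEssential _~_ = ∀ x → x ~ e → x ≈ e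

record EssentialCongruence (n : ℕ) : Set₁ where
  field
    _~_          : Rel (S n) 0ℓ
    isCongruence : IsSemilatticeCongruence _~_
    isEssential  : IsEssential _~_

module _ (C : EssentialCongruence n) where
  open EssentialCongruence C

  -- p is the element π↓(w): a minimal element of the class of w.
  IsMinimalInClassOf : S n → S n → Set
  IsMinimalInClassOf w p = w ~ p × (∀ q → w ~ q → q ≤ᴸ p → q ≈ p)

  -- The graph of the stack-sorting operator: v = w · π↓(w)⁻¹.
  StackSorts : S n → S n → Set
  StackSorts w v = ∃[ p ] IsMinimalInClassOf w p × v ≈ w · p ⁻¹

  -- k = |D_R(v)| for some w, where v is the image of w under stack-sorting.
  DescentCount : Pred ℕ 0ℓ
  DescentCount k = ∃[ w ] ∃[ v ] StackSorts w v × ∣ D_R v ∣ ≡ k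

IsMaximumOf : Pred ℕ a → ℕ → Set a
IsMaximumOf P m = P m × (∀ k → P k → k ≤ m)

{-# OPTIONS --safe #-}

-- Let δ(x, y) be the number of pairs of positions which x and y order oppositely.
-- It is a right-invariant metric, ℓ(y x⁻¹) = δ(x, y), and x ≤ᴸ y means that x lies on
-- a geodesic from e to y.
--
-- Upper bound: if all simple reflections are descents of v = w p⁻¹, where p ≡ w, then v is
-- decreasing, so e lies on a geodesic from p to w and w ∧ p = e. Then e = w ∧ p ≡ p ∧ p = p ≡ w,
-- so w = p = e since ≡ is essential, and v = e has no descents.
--
-- Sharpness: call x and y equivalent if they have the same lower bounds in a fixed set A.
-- This is a semilattice congruence, and it is essential if A contains all atoms s i. Take
-- A = {atoms} ∪ {p} for the shuffle p = 1 (k+1) 2 (k+2) ⋯, k = ⌈n/2⌉, and let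
-- w = k n (k−1) (n−1) ⋯. These have the same descents and p ≤ᴸ w, so p is minimal in the
-- class of w, and w p⁻¹ = k ⋯ 2 1 n ⋯ (k+2) (k+1) has n − 2 descents.

module Submission where

open import Defs
open import Data.Nat.Base using (ℕ; _≤_; _∸_)
open import Data.Product.Base using (Σ-syntax)

open import Algebra.Properties.CommutativeMonoid.Sum as Sum using ()
open import Data.Bool.Base using (Bool; true; false; not; if_then_else_)
open import Data.Bool.Properties as Bool using ()
open import Data.Fin.Base as Fin
  using (Fin; zero; suc; toℕ; fromℕ; fromℕ<; inject₁; opposite)
open import Data.Fin.Induction
  using (<-weakInduction; >-weakInduction; <-weakInduction-startingFrom)
open import Data.Fin.Permutation
  using (permutation; _⟨$⟩ʳ_; _⟨$⟩ˡ_; _≈_; inverseˡ; inverseʳ)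
open import Data.Fin.Permutation.Components using (transpose)
open import Data.Fin.Properties
  using (_≟_; _<?_; <-cmp; any?; all?; ¬∀⟶∃¬; toℕ-inject₁; toℕ-injective; toℕ-fromℕ;
         toℕ-fromℕ<; toℕ<n; injective⇒≤; punchOut-injective; opposite-prop;
         opposite-involutive)
open import Data.Fin.Subset using (Subset; ∣_∣; inside; outside)
open import Data.Fin.Subset.Properties using (∣p∣≤n; ∣p∣≡n⇒p≡⊤)
open import Data.Integer.Base as ℤ using () renaming (+_ to pos)
open import Data.Integer.Properties as ℤ using ()
open import Data.Maybe.Base using (Maybe; just; nothing)
open import Data.Nat.Base using (zero; suc; _+_; _*_; _<_; z≤n; s≤s)
open import Data.Nat.Properties as ℕ using (+-0-commutativeMonoid)
open import Data.Product.Base using (∃-syntax; _×_; _,_; proj₁; proj₂)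
open import Data.Sum.Base as Sum⊎ using (_⊎_; inj₁; inj₂)
open import Data.Vec.Base using ([]; _∷_; lookup)
open import Data.Vec.Properties using (lookup∘tabulate; lookup-replicate)
open import Function.Base using (_∘_)
open import Level using (0ℓ)
open import Relation.Binary.Core using (Rel)
open import Relation.Binary.Definitions using (tri<; tri≈; tri>)
open import Relation.Binary.PropositionalEquality
  using (_≡_; _≢_; refl; sym; trans; cong; cong₂; subst; subst₂; module ≡-Reasoning)
open import Relation.Binary.Structures using (IsEquivalence)
open import Relation.Nullary using (¬_; Dec; yes; no; does; contradiction)
open import Relation.Nullary.Decidable using (⌊_⌋; dec-true; dec-false; isYes≗does)

open Sum +-0-commutativeMonoid
  using (sum; sum-cong-≗; sum-permute; ∑-comm; ∑-distrib-+; sum-replicate-zero)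

private
  variable
    n : ℕ

-- Finite sums of natural numbers.

sum-mono-≤ : {f g : Fin n → ℕ} → (∀ i → f i ≤ g i) → sum f ≤ sum g
sum-mono-≤ {zero}  f≤g = z≤n
sum-mono-≤ {suc n} f≤g = ℕ.+-mono-≤ (f≤g zero) (sum-mono-≤ (f≤g ∘ suc))

sum-mono-< : {f g : Fin n → ℕ} → (∀ i → f i ≤ g i) → ∀ i → f i < g i → sum f < sum g
sum-mono-< f≤g zero    fi<gi = ℕ.+-mono-<-≤ fi<gi (sum-mono-≤ (f≤g ∘ suc))
sum-mono-< f≤g (suc i) fi<gi = ℕ.+-mono-≤-< (f≤g zero) (sum-mono-< (f≤g ∘ suc) i fi<gi)

sum-zero : {f : Fin n → ℕ} → (∀ i → f i ≡ 0) → sum f ≡ 0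
sum-zero {n} f≡0 = trans (sum-cong-≗ f≡0) (sum-replicate-zero n)

sum-single : {f : Fin n → ℕ} (i : Fin n) → (∀ j → j ≢ i → f j ≡ 0) → sum f ≡ f i
sum-single {f = f} zero f≡0 =
  trans (cong (f zero +_) (sum-zero λ j → f≡0 (suc j) λ ())) (ℕ.+-identityʳ (f zero))
sum-single (suc i)     f≡0 =
  cong₂ _+_ (f≡0 zero λ ()) (sum-single i λ j j≢i → f≡0 (suc j) λ { refl → j≢i refl })

∑∑ : (Fin n → Fin n → ℕ) → ℕ
∑∑ f = sum λ a → sum (f a)

∑∑-cong : {f g : Fin n → Fin n → ℕ} → (∀ a b → f a b ≡ g a b) → ∑∑ f ≡ ∑∑ g
∑∑-cong f≡g = sum-cong-≗ λ a → sum-cong-≗ (f≡g a)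

∑∑-mono-≤ : {f g : Fin n → Fin n → ℕ} → (∀ a b → f a b ≤ g a b) → ∑∑ f ≤ ∑∑ g
∑∑-mono-≤ f≤g = sum-mono-≤ λ a → sum-mono-≤ (f≤g a)

∑∑-+ : (f g : Fin n → Fin n → ℕ) → ∑∑ (λ a b → f a b + g a b) ≡ ∑∑ f + ∑∑ g
∑∑-+ f g = trans (sum-cong-≗ λ a → ∑-distrib-+ (f a) (g a))
                 (∑-distrib-+ (λ a → sum (f a)) (λ a → sum (g a)))

∑∑-permute : (f : Fin n → Fin n → ℕ) (z : S n) →
             ∑∑ f ≡ ∑∑ (λ a b → f (z ⟨$⟩ʳ a) (z ⟨$⟩ʳ b))
∑∑-permute f z = trans (sum-permute (λ a → sum (f a)) z)
                       (sum-cong-≗ λ a → sum-permute (f (z ⟨$⟩ʳ a)) z)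

-- Relative order of two positions.

χ : ℕ → ℕ → ℕ
χ k l = if does (k ℕ.<? l) then 1 else 0

χ-< : ∀ {k l} → k < l → χ k l ≡ 1
χ-< k<l = cong (if_then 1 else 0) (dec-true (_ ℕ.<? _) k<l)

χ-≮ : ∀ {k l} → ¬ k < l → χ k l ≡ 0
χ-≮ k≮l = cong (if_then 1 else 0) (dec-false (_ ℕ.<? _) k≮l)

before : S n → Fin n → Fin n → ℕ
before x a b = χ (toℕ (x ⟨$⟩ʳ a)) (toℕ (x ⟨$⟩ʳ b))

injective : (x : S n) {a b : Fin n} → x ⟨$⟩ʳ a ≡ x ⟨$⟩ʳ b → a ≡ b
injective x xa≡xb =
  trans (sym (inverseˡ x)) (trans (cong (x ⟨$⟩ˡ_) xa≡xb) (inverseˡ x))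

before-pair : (x : S n) {a b : Fin n} → a ≢ b →
              (before x a b ≡ 1 × before x b a ≡ 0) ⊎ (before x a b ≡ 0 × before x b a ≡ 1)
before-pair x {a} {b} a≢b with <-cmp (x ⟨$⟩ʳ a) (x ⟨$⟩ʳ b)
... | tri< lt _ ngt = inj₁ (χ-< lt , χ-≮ ngt)
... | tri≈ _ eq _   = contradiction (injective x eq) a≢b
... | tri> nlt _ gt = inj₂ (χ-≮ nlt , χ-< gt)

before-diag : (x : S n) (a : Fin n) → before x a a ≡ 0
before-diag x a = χ-≮ (ℕ.<-irrefl {toℕ (x ⟨$⟩ʳ a)} refl)

-- The middle argument is the one between the others: wherever `y` departs from `x`, `z` sides with
-- `y`. For `x = e` this is inclusion of the inversion set of `y` in that of `z`, inversions being
-- pairs of positions.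
Between : S n → S n → S n → Set
Between x y z = ∀ a b → x ⟨$⟩ʳ a Fin.< x ⟨$⟩ʳ b → y ⟨$⟩ʳ b Fin.< y ⟨$⟩ʳ a →
                z ⟨$⟩ʳ b Fin.< z ⟨$⟩ʳ a

-- Adjacent transpositions.

module _ (i j : Fin n) where

  transpose-matchˡ : transpose i j i ≡ j
  transpose-matchˡ rewrite dec-true (i ≟ i) refl = refl

  transpose-matchʳ : transpose i j j ≡ i
  transpose-matchʳ with j ≟ i
  ... | yes j≡i = j≡i
  ... | no _ rewrite dec-true (j ≟ j) refl = refl

  transpose-mismatch : ∀ {k} → k ≢ i → k ≢ j → transpose i j k ≡ k
  transpose-mismatch {k} k≢i k≢j
    rewrite dec-false (k ≟ i) k≢i | dec-false (k ≟ j) k≢j = refl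

inject₁<suc : (i : Fin n) → inject₁ i Fin.< suc i
inject₁<suc i = s≤s (ℕ.≤-reflexive (toℕ-inject₁ i))

data SView (i : Fin n) (k : Fin (suc n)) : Set where
  left  : k ≡ inject₁ i → toℕ k ≡ toℕ i → s i ⟨$⟩ʳ k ≡ suc i → SView i k
  right : k ≡ suc i → s i ⟨$⟩ʳ k ≡ inject₁ i → SView i k
  fixed : k ≢ inject₁ i → k ≢ suc i → s i ⟨$⟩ʳ k ≡ k → SView i k

s-view : (i : Fin n) (k : Fin (suc n)) → SView i k
s-view i k = view (k ≟ inject₁ i) (k ≟ suc i)
  where
  view : Dec (k ≡ inject₁ i) → Dec (k ≡ suc i) → SView i k
  view (yes refl) _         = left refl (toℕ-inject₁ i) (transpose-matchˡ (inject₁ i) (suc i))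
  view (no _)    (yes refl) = right refl (transpose-matchʳ (inject₁ i) (suc i))
  view (no k≢)   (no k≢′)   = fixed k≢ k≢′ (transpose-mismatch (inject₁ i) (suc i) k≢ k≢′)

-- A simple reflection moves every value by at most one step, so only the two swapped neighbours can
-- change order. `δ-s`, `descent⇒δ` and `ascent⇒δ` rest on this.
s-inversion : (i : Fin n) (a b : Fin (suc n)) → a Fin.< b → s i ⟨$⟩ʳ b Fin.< s i ⟨$⟩ʳ a →
              a ≡ inject₁ i × b ≡ suc i
s-inversion i a b a<b sb<sa with s-view i a | s-view i b
... | left a≡ _ _ | right b≡ _ = a≡ , b≡
... | left refl _ _ | left refl _ _ = contradiction a<b (ℕ.<-irrefl refl)
... | left _ a≡ sa≡ | fixed _ _ sb≡ rewrite sa≡ | sb≡ | a≡ = contradiction sb<sa (ℕ.≤⇒≯ a<b)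
... | right refl _ | left refl _ _ = contradiction a<b (ℕ.<⇒≯ (inject₁<suc i))
... | right refl _ | right refl _ = contradiction a<b (ℕ.<-irrefl refl)
... | right refl sa≡ | fixed _ _ sb≡ rewrite sa≡ | sb≡ | toℕ-inject₁ i =
  contradiction (ℕ.<-trans sb<sa (ℕ.n<1+n _)) (ℕ.<⇒≯ a<b)
... | fixed _ _ sa≡ | left _ b≡ sb≡ rewrite sa≡ | sb≡ | b≡ =
  contradiction (ℕ.<-trans a<b (ℕ.n<1+n _)) (ℕ.<⇒≯ sb<sa)
... | fixed _ _ sa≡ | right refl sb≡ rewrite sa≡ | sb≡ | toℕ-inject₁ i =
  contradiction sb<sa (ℕ.≤⇒≯ (ℕ.≤-pred a<b))
... | fixed _ _ sa≡ | fixed _ _ sb≡ rewrite sa≡ | sb≡ = contradiction sb<sa (ℕ.<⇒≯ a<b)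

s⁻¹≈s : (i : Fin n) → s {suc n} i ⁻¹ ≈ s i
s⁻¹≈s i k with s-view i k
... | left refl _ sk≡ = trans (transpose-matchʳ (suc i) (inject₁ i)) (sym sk≡)
... | right refl sk≡ = trans (transpose-matchˡ (suc i) (inject₁ i)) (sym sk≡)
... | fixed k≢ k≢′ sk≡ = trans (transpose-mismatch (suc i) (inject₁ i) k≢′ k≢) (sym sk≡)

-- Metric properties of the inversion distance.

abstract
  -- The Kendall tau distance.
  δ : S n → S n → ℕ
  δ x y = ∑∑ λ a b → before x a b * before y b a

  δ-cong : (x x′ y y′ : S n) → x ≈ x′ → y ≈ y′ → δ x y ≡ δ x′ y′
  δ-cong _ _ _ _ x≈ y≈ = ∑∑-cong λ a b →
    cong₂ _*_ (cong₂ χ (cong toℕ (x≈ a)) (cong toℕ (x≈ b)))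
              (cong₂ χ (cong toℕ (y≈ b)) (cong toℕ (y≈ a)))

  δ-sym : (x y : S n) → δ x y ≡ δ y x
  δ-sym x y = trans
    (∑∑-cong λ a b → ℕ.*-comm (before x a b) (before y b a))
    (∑-comm λ a b → before y b a * before x a b)

  -- Right multiplication only relabels positions, and the sum runs over all pairs of them.
  δ-·ʳ : (x y z : S n) → δ (x · z) (y · z) ≡ δ x y
  δ-·ʳ x y z = sym (∑∑-permute (λ a b → before x a b * before y b a) z)

  -- A pair on which `x` and `z` disagree also separates `x` from `y` or `y` from `z`.
  δ-triangle : (x y z : S n) → δ x z ≤ δ x y + δ y z
  δ-triangle x y z = ℕ.≤-trans (∑∑-mono-≤ pointwise) (ℕ.≤-reflexive
    (∑∑-+ (λ a b → before x a b * before y b a) (λ a b → before y a b * before z b a)))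
    where
    pointwise : ∀ a b → before x a b * before z b a ≤
                before x a b * before y b a + before y a b * before z b a
    pointwise a b with a ≟ b
    ... | yes refl rewrite before-diag x a | before-diag y a = z≤n
    ... | no a≢b with before-pair x a≢b | before-pair y a≢b
    ...   | inj₂ (x0 , _) | _ rewrite x0 = z≤n
    ...   | inj₁ (x1 , _) | inj₁ (y1 , y0) rewrite x1 | y1 | y0 = ℕ.≤-refl
    ...   | inj₁ (x1 , _) | inj₂ (y0 , y1) rewrite x1 | y1 | y0 with before-pair z a≢b
    ...     | inj₁ (_ , z0) rewrite z0 = z≤n
    ...     | inj₂ (_ , z1) rewrite z1 = ℕ.≤-refl

  -- Strict inequality in the triangle comes from pairs on which `y` disagrees with both `x` and
  -- `z`; `Between` excludes these.
  δ-between : (x y z : S n) → Between x y z → δ x z ≡ δ x y + δ y z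
  δ-between x y z xyz = trans (∑∑-cong pointwise)
    (∑∑-+ (λ a b → before x a b * before y b a) (λ a b → before y a b * before z b a))
    where
    pointwise : ∀ a b → before x a b * before z b a ≡
                before x a b * before y b a + before y a b * before z b a
    pointwise a b with <-cmp (x ⟨$⟩ʳ a) (x ⟨$⟩ʳ b) | <-cmp (y ⟨$⟩ʳ a) (y ⟨$⟩ʳ b)
    ... | tri≈ _ eq _ | _ with injective x eq
    ...   | refl rewrite before-diag x a | before-diag y a = refl
    pointwise a b | _ | tri≈ _ eq _ with injective y eq
    ...   | refl rewrite before-diag x a | before-diag y a = refl
    pointwise a b | tri< x< _ _ | tri> y≮ _ y>
      rewrite χ-< x< | χ-≮ y≮ | χ-< y> | χ-< (xyz a b x< y>) = refl
    pointwise a b | tri< x< _ _ | tri< y< _ y≯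
      rewrite χ-< x< | χ-< y< | χ-≮ y≯ = refl
    pointwise a b | tri> x≮ _ x> | tri> y≮ _ _
      rewrite χ-≮ x≮ | χ-≮ y≮ = refl
    pointwise a b | tri> x≮ _ x> | tri< y< _ _
      rewrite χ-≮ x≮ | χ-< y< | χ-≮ (ℕ.<⇒≯ (xyz b a x> y<)) = refl

  δ-self : (x : S n) → δ x x ≡ 0
  δ-self x = sum-zero λ a → sum-zero (pointwise a)
    where
    pointwise : ∀ a b → before x a b * before x b a ≡ 0
    pointwise a b with a ≟ b
    ... | yes refl rewrite before-diag x a = refl
    ... | no a≢b with before-pair x a≢b
    ...   | inj₁ (x1 , x0) rewrite x1 | x0 = refl
    ...   | inj₂ (x0 , _) rewrite x0 = refl

  δ-s : (i : Fin n) → δ e (s {suc n} i) ≡ 1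
  δ-s {n} i = trans (sum-single (inject₁ i) λ a a≢ → sum-zero λ b → vanish a b (a≢ ∘ proj₁))
    (trans (sum-single (suc i) λ b b≢ → vanish (inject₁ i) b (b≢ ∘ proj₂))
           (cong₂ _*_ (χ-< (inject₁<suc i)) (χ-< swapped)))
    where
    swapped : s i ⟨$⟩ʳ suc i Fin.< s i ⟨$⟩ʳ inject₁ i
    swapped rewrite transpose-matchˡ (inject₁ i) (suc i) | transpose-matchʳ (inject₁ i) (suc i) =
      inject₁<suc i

    vanish : ∀ a b → ¬ (a ≡ inject₁ i × b ≡ suc i) → before e a b * before (s {suc n} i) b a ≡ 0
    vanish a b ¬p with a <? b | (s i ⟨$⟩ʳ b) <? (s i ⟨$⟩ʳ a)
    ... | no a≮b  | _         = cong (_* before (s i) b a) (χ-≮ a≮b)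
    ... | yes _   | no sb≮sa  = trans (cong (before e a b *_) (χ-≮ sb≮sa)) (ℕ.*-zeroʳ (before e a b))
    ... | yes a<b | yes sb<sa = contradiction (s-inversion i a b a<b sb<sa) ¬p

δ-⁻¹ : (x : S n) → δ e (x ⁻¹) ≡ δ e x
δ-⁻¹ x = begin
  δ e (x ⁻¹)              ≡⟨ δ-·ʳ e (x ⁻¹) x ⟨
  δ (e · x) (x ⁻¹ · x)    ≡⟨ δ-cong (e · x) x (x ⁻¹ · x) e (λ _ → refl) (λ _ → inverseˡ x) ⟩
  δ x e                   ≡⟨ δ-sym x e ⟩
  δ e x                   ∎
  where open ≡-Reasoning

-- Right translation by `x ⁻¹`. Together with `ℓ≡δ` it turns the equation defining `≤ᴸ` into
-- additivity of distances.
δ-quotient : (x y : S n) → δ e (y · x ⁻¹) ≡ δ x y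
δ-quotient x y = begin
  δ e (y · x ⁻¹)          ≡⟨ δ-cong e (x · x ⁻¹) (y · x ⁻¹) (y · x ⁻¹)
                               (λ _ → sym (inverseʳ x)) (λ _ → refl) ⟩
  δ (x · x ⁻¹) (y · x ⁻¹) ≡⟨ δ-·ʳ x y (x ⁻¹) ⟩
  δ x y                   ∎
  where open ≡-Reasoning

-- Descents, words and Coxeter length.

Descent : S (suc n) → Fin n → Set
Descent x i = x ⟨$⟩ʳ suc i Fin.< x ⟨$⟩ʳ inject₁ i

¬ascent⇒descent : (x : S (suc n)) (i : Fin n) →
                  ¬ x ⟨$⟩ʳ inject₁ i Fin.< x ⟨$⟩ʳ suc i → Descent x i
¬ascent⇒descent x i ≮ with <-cmp (x ⟨$⟩ʳ inject₁ i) (x ⟨$⟩ʳ suc i)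
... | tri< lt _ _ = contradiction lt ≮
... | tri≈ _ eq _ = contradiction (inject₁<suc i) (ℕ.<-irrefl (cong toℕ (injective x eq)))
... | tri> _ _ gt = gt

adjacent⇒< : {R : Fin (suc n) → Fin (suc n) → Set} →
             (∀ {i j k} → R i j → R j k → R i k) →
             (∀ i → R (inject₁ i) (suc i)) → ∀ {i j} → i Fin.< j → R i j
adjacent⇒< {R = R} R-trans step {i} {j} i<j =
  -- With `i Fin.< j` inside the motive the induction can start at `i` itself, where the claim is
  -- vacuous.
  <-weakInduction-startingFrom (λ j → i Fin.< j → R i j)
    (λ i<i → contradiction i<i (ℕ.<-irrefl refl)) next (ℕ.<⇒≤ i<j) i<j
  where
  next : ∀ k → (i Fin.< inject₁ k → R i (inject₁ k)) → i Fin.< suc k → R i (suc k)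
  next k ih i<1+k with <-cmp i (inject₁ k)
  ... | tri< i<k _ _  = R-trans (ih i<k) (step k)
  ... | tri≈ _ refl _ = step k
  ... | tri> _ _ k<i  =
    contradiction (ℕ.≤-pred i<1+k) (ℕ.<⇒≱ (subst (_< toℕ i) (toℕ-inject₁ k) k<i))

-- A strictly increasing map has values at most `i` by induction down from the last position, and at
-- least `i` by induction up from the first.
ascending⇒≈e : (x : S (suc n)) → (∀ i → x ⟨$⟩ʳ inject₁ i Fin.< x ⟨$⟩ʳ suc i) → x ≈ e
ascending⇒≈e {n} x asc i = toℕ-injective (ℕ.≤-antisym
  (>-weakInduction (λ i → toℕ (x ⟨$⟩ʳ i) ≤ toℕ i) top down i)
  (<-weakInduction (λ i → toℕ i ≤ toℕ (x ⟨$⟩ʳ i)) z≤n up i))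
  where
  top : toℕ (x ⟨$⟩ʳ fromℕ n) ≤ toℕ (fromℕ n)
  top rewrite toℕ-fromℕ n = ℕ.≤-pred (toℕ<n (x ⟨$⟩ʳ fromℕ n))

  down : ∀ i → toℕ (x ⟨$⟩ʳ suc i) ≤ toℕ (suc i) → toℕ (x ⟨$⟩ʳ inject₁ i) ≤ toℕ (inject₁ i)
  down i ih rewrite toℕ-inject₁ i = ℕ.≤-pred (ℕ.≤-trans (asc i) ih)

  up : ∀ i → toℕ (inject₁ i) ≤ toℕ (x ⟨$⟩ʳ inject₁ i) → toℕ (suc i) ≤ toℕ (x ⟨$⟩ʳ suc i)
  up i ih rewrite toℕ-inject₁ i = ℕ.≤-trans (s≤s ih) (asc i)

≈e-or-descent : (x : S (suc n)) → x ≈ e ⊎ ∃[ i ] Descent x i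
≈e-or-descent {n} x with all? (λ i → (x ⟨$⟩ʳ inject₁ i) <? (x ⟨$⟩ʳ suc i))
... | yes asc = inj₁ (ascending⇒≈e x asc)
... | no ¬asc with ¬∀⟶∃¬ n _ (λ i → (x ⟨$⟩ʳ inject₁ i) <? (x ⟨$⟩ʳ suc i)) ¬asc
...   | i , ≮ = inj₂ (i , ¬ascent⇒descent x i ≮)

-- The only inversion of `s i` is also one of `x`, so `s i` lies on a geodesic from `e` to `x`.
descent⇒δ : (x : S (suc n)) (i : Fin n) → Descent x i → δ e x ≡ suc (δ (s i) x)
descent⇒δ {n} x i desc = trans (δ-between e (s i) x between) (cong (_+ δ (s i) x) (δ-s i))
  where
  between : Between e (s i) x
  between a b a<b sb<sa with s-inversion i a b a<b sb<sa
  ... | refl , refl = desc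

s-involutive : (i : Fin n) → s {suc n} i · s i ≈ e
s-involutive i k = trans (sym (s⁻¹≈s i (s i ⟨$⟩ʳ k))) (inverseˡ (s i))

-- A letter at the front of a word acts on values, so the one to split off is found at a descent of
-- `w ⁻¹`. Removing it lowers `δ e` by exactly one, whence the recursion on `k`.
δ-hasWord : ∀ k (w : S (suc n)) → δ e w ≡ k → HasWord w k
δ-hasWord {n} k w δ≡k with ≈e-or-descent (w ⁻¹)
... | inj₁ w⁻¹≈e = subst (HasWord w) 0≡k ([] , λ j → trans (sym (inverseˡ w)) (w⁻¹≈e (w ⟨$⟩ʳ j)))
  where
  0≡k : 0 ≡ k
  0≡k = begin
    0            ≡⟨ δ-self e ⟨
    δ e e        ≡⟨ δ-cong e e (w ⁻¹) e (λ _ → refl) w⁻¹≈e ⟨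
    δ e (w ⁻¹)   ≡⟨ δ-⁻¹ w ⟩
    δ e w        ≡⟨ δ≡k ⟩
    k            ∎
    where open ≡-Reasoning
... | inj₂ (i , desc) = extend k shorter
  where
  shorter : k ≡ suc (δ e (s i · w))
  shorter = begin
    k                          ≡⟨ δ≡k ⟨
    δ e w                      ≡⟨ δ-⁻¹ w ⟨
    δ e (w ⁻¹)                 ≡⟨ descent⇒δ (w ⁻¹) i desc ⟩
    suc (δ (s i) (w ⁻¹))       ≡⟨ cong suc (δ-quotient (s i) (w ⁻¹)) ⟨
    suc (δ e ((s i · w) ⁻¹))   ≡⟨ cong suc (δ-⁻¹ (s i · w)) ⟩
    suc (δ e (s i · w))        ∎
    where open ≡-Reasoning

  extend : ∀ k → k ≡ suc (δ e (s i · w)) → HasWord w k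
  extend zero    ()
  extend (suc k) k≡ with δ-hasWord k (s i · w) (sym (ℕ.suc-injective k≡))
  ... | u , u≈ = i ∷ u , λ j → trans (cong (s i ⟨$⟩ʳ_) (u≈ j)) (s-involutive i (w ⟨$⟩ʳ j))

-- A new front letter adds at most one: after translation the distance is that from `v ⁻¹` to `s i`,
-- and the detour through `e` has length `δ e v + 1`.
δ-word : ∀ {k} (u : Word (suc n) k) → δ e (⟦_⟧ {suc n} u) ≤ k
δ-word []              = ℕ.≤-reflexive (δ-self e)
δ-word {n} {suc k} (i ∷ u) = begin
  δ e (s i · v)          ≡⟨ δ-quotient (v ⁻¹) (s i) ⟩
  δ (v ⁻¹) (s i)         ≤⟨ δ-triangle (v ⁻¹) e (s i) ⟩
  δ (v ⁻¹) e + δ e (s i) ≡⟨ cong₂ _+_ (trans (δ-sym (v ⁻¹) e) (δ-⁻¹ v)) (δ-s i) ⟩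
  δ e v + 1              ≤⟨ ℕ.+-monoˡ-≤ 1 (δ-word u) ⟩
  k + 1                  ≡⟨ ℕ.+-comm k 1 ⟩
  suc k                  ∎
  where
  open ℕ.≤-Reasoning

  v : S (suc n)
  v = ⟦_⟧ {suc n} u

ℓ≡δ : (w : S (suc n)) → ℓ w ≡ δ e w
ℓ≡δ {n} w with ℓ-word w
... | u , u≈w = ℕ.≤-antisym (ℓ-least w (δ e w) (δ-hasWord (δ e w) w refl))
  (subst (_≤ ℓ w) (δ-cong e e (⟦_⟧ {suc n} u) w (λ _ → refl) u≈w) (δ-word u))

-- The left weak order in terms of distances.

ℓ-quotient : (x y : S (suc n)) → ℓ (y · x ⁻¹) ≡ δ x y
ℓ-quotient x y = trans (ℓ≡δ (y · x ⁻¹)) (δ-quotient x y)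

-- The quotient `y · x ⁻¹` has a word of length 0, and that word can only be empty.
δ≡0⇒≈ : (x y : S (suc n)) → δ x y ≡ 0 → x ≈ y
δ≡0⇒≈ x y δ≡0 i with δ-hasWord 0 (y · x ⁻¹) (trans (δ-quotient x y) δ≡0)
... | [] , eq = trans (eq (x ⟨$⟩ʳ i)) (cong (y ⟨$⟩ʳ_) (inverseˡ x))

-- A form of `≤ᴸ` without subtraction, so that the order laws follow from the metric axioms over the
-- naturals.
_⊑_ : S n → S n → Set
x ⊑ y = δ e x + δ x y ≡ δ e y

⊑⇒≤ᴸ : (x y : S (suc n)) → x ⊑ y → x ≤ᴸ y
⊑⇒≤ᴸ x y x⊑y rewrite ℓ-quotient x y | ℓ≡δ x | ℓ≡δ y | sym x⊑y = begin
  pos b                     ≡⟨ ℤ.+-cancelˡ-⊖ a b 0 ⟨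
  (a + b) ℤ.⊖ (a + 0)       ≡⟨ cong ((a + b) ℤ.⊖_) (ℕ.+-identityʳ a) ⟩
  (a + b) ℤ.⊖ a             ≡⟨ ℤ.m-n≡m⊖n (a + b) a ⟨
  pos (a + b) ℤ.- pos a     ∎
  where
  open ≡-Reasoning

  a b : ℕ
  a = δ e x
  b = δ x y

≤ᴸ⇒⊑ : (x y : S (suc n)) → x ≤ᴸ y → x ⊑ y
≤ᴸ⇒⊑ x y x≤y rewrite ℓ-quotient x y | ℓ≡δ x | ℓ≡δ y = ℤ.+-injective (begin
  a ℤ.+ pos (δ x y)         ≡⟨ cong (λ d → a ℤ.+ d) x≤y ⟩
  a ℤ.+ (c ℤ.- a)           ≡⟨ ℤ.+-comm a (c ℤ.- a) ⟩
  (c ℤ.- a) ℤ.+ a           ≡⟨ ℤ.+-assoc c (ℤ.- a) a ⟩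
  c ℤ.+ (ℤ.- a ℤ.+ a)       ≡⟨ cong (λ d → c ℤ.+ d) (ℤ.+-inverseˡ a) ⟩
  c ℤ.+ pos 0               ≡⟨ ℤ.+-identityʳ c ⟩
  c                         ∎)
  where
  open ≡-Reasoning

  a c : ℤ.ℤ
  a = pos (δ e x)
  c = pos (δ e y)

⊑-trans : {x y z : S n} → x ⊑ y → y ⊑ z → x ⊑ z
⊑-trans {x = x} {y} {z} x⊑y y⊑z = ℕ.≤-antisym
  (begin
    δ e x + δ x z             ≤⟨ ℕ.+-monoʳ-≤ (δ e x) (δ-triangle x y z) ⟩
    δ e x + (δ x y + δ y z)   ≡⟨ ℕ.+-assoc (δ e x) (δ x y) (δ y z) ⟨
    δ e x + δ x y + δ y z     ≡⟨ cong (_+ δ y z) x⊑y ⟩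
    δ e y + δ y z             ≡⟨ y⊑z ⟩
    δ e z                     ∎)
  (δ-triangle e x z)
  where open ℕ.≤-Reasoning

⊑-antisym : {x y : S (suc n)} → x ⊑ y → y ⊑ x → x ≈ y
⊑-antisym {x = x} {y} x⊑y y⊑x = δ≡0⇒≈ x y (ℕ.m+n≡0⇒m≡0 (δ x y)
  (ℕ.+-cancelˡ-≡ (δ e x) (δ x y + δ y x) 0 (begin
    δ e x + (δ x y + δ y x)   ≡⟨ ℕ.+-assoc (δ e x) (δ x y) (δ y x) ⟨
    δ e x + δ x y + δ y x     ≡⟨ cong (_+ δ y x) x⊑y ⟩
    δ e y + δ y x             ≡⟨ y⊑x ⟩
    δ e x                     ≡⟨ ℕ.+-identityʳ (δ e x) ⟨
    δ e x + 0                 ∎)))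
  where open ≡-Reasoning

≤ᴸ-refl : (x : S (suc n)) → x ≤ᴸ x
≤ᴸ-refl x = ⊑⇒≤ᴸ x x (trans (cong (δ e x +_) (δ-self x)) (ℕ.+-identityʳ (δ e x)))

≤ᴸ-trans : (x y z : S (suc n)) → x ≤ᴸ y → y ≤ᴸ z → x ≤ᴸ z
≤ᴸ-trans x y z x≤y y≤z = ⊑⇒≤ᴸ x z (⊑-trans (≤ᴸ⇒⊑ x y x≤y) (≤ᴸ⇒⊑ y z y≤z))

≤ᴸ-antisym : (x y : S (suc n)) → x ≤ᴸ y → y ≤ᴸ x → x ≈ y
≤ᴸ-antisym x y x≤y y≤x = ⊑-antisym (≤ᴸ⇒⊑ x y x≤y) (≤ᴸ⇒⊑ y x y≤x)

≤ᴸ-respʳ-≈ : (x y z : S (suc n)) → y ≈ z → x ≤ᴸ y → x ≤ᴸ z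
≤ᴸ-respʳ-≈ x y z y≈z x≤y = ⊑⇒≤ᴸ x z (begin
  δ e x + δ x z   ≡⟨ cong (δ e x +_) (δ-cong x x y z (λ _ → refl) y≈z) ⟨
  δ e x + δ x y   ≡⟨ ≤ᴸ⇒⊑ x y x≤y ⟩
  δ e y           ≡⟨ δ-cong e e y z (λ _ → refl) y≈z ⟩
  δ e z           ∎)
  where open ≡-Reasoning

e≤ᴸ : (x : S (suc n)) → e ≤ᴸ x
e≤ᴸ x = ⊑⇒≤ᴸ e x (cong (_+ δ e x) (δ-self e))

between⇒≤ᴸ : (x y : S (suc n)) → Between e x y → x ≤ᴸ y
between⇒≤ᴸ x y exy = ⊑⇒≤ᴸ x y (sym (δ-between e x y exy))

-- Right descents and the atoms of the weak order.

ℓ-·s : (x : S (suc n)) (i : Fin n) → ℓ (x · s i) ≡ δ (s i) x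
ℓ-·s x i = begin
  ℓ (x · s i)            ≡⟨ ℓ≡δ (x · s i) ⟩
  δ e (x · s i)          ≡⟨ δ-cong e e (x · s i) (x · s i ⁻¹) (λ _ → refl)
                              (λ k → cong (x ⟨$⟩ʳ_) (sym (s⁻¹≈s i k))) ⟩
  δ e (x · s i ⁻¹)       ≡⟨ δ-quotient (s i) x ⟩
  δ (s i) x              ∎
  where open ≡-Reasoning

descent⇒ℓ< : (x : S (suc n)) (i : Fin n) → Descent x i → ℓ (x · s i) < ℓ x
descent⇒ℓ< x i desc rewrite ℓ-·s x i | ℓ≡δ x | descent⇒δ x i desc = ℕ.≤-refl

-- At an ascent `x` sides with `e` on the one pair that `s i` inverts, so `e` lies on a geodesic
-- from `s i` to `x`.
ascent⇒δ : (x : S (suc n)) (i : Fin n) → x ⟨$⟩ʳ inject₁ i Fin.< x ⟨$⟩ʳ suc i →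
           δ (s i) x ≡ suc (δ e x)
ascent⇒δ {n} x i asc =
  trans (δ-between (s i) e x between) (cong (_+ δ e x) (trans (δ-sym (s i) e) (δ-s i)))
  where
  between : Between (s {suc n} i) e x
  between a b sa<sb b<a with s-inversion i b a b<a sa<sb
  ... | refl , refl = asc

ℓ<⇒descent : (x : S (suc n)) (i : Fin n) → ℓ (x · s i) < ℓ x → Descent x i
ℓ<⇒descent x i ℓ< rewrite ℓ-·s x i | ℓ≡δ x =
  ¬ascent⇒descent x i λ asc → ℕ.<-asym ℓ< (ℕ.≤-reflexive (sym (ascent⇒δ x i asc)))

descent⇒s≤ᴸ : (x : S (suc n)) (i : Fin n) → Descent x i → s i ≤ᴸ x
descent⇒s≤ᴸ x i desc =
  ⊑⇒≤ᴸ (s i) x (trans (cong (_+ δ (s i) x) (δ-s i)) (sym (descent⇒δ x i desc)))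

s≤ᴸ⇒descent : (x : S (suc n)) (i : Fin n) → s i ≤ᴸ x → Descent x i
s≤ᴸ⇒descent x i si≤x = ¬ascent⇒descent x i λ asc →
  ℕ.<⇒≱ (ℕ.≤-reflexive (sym (ascent⇒δ x i asc)))
        (ℕ.≤-trans (ℕ.m≤n+m (δ (s i) x) (δ e (s i))) (ℕ.≤-reflexive (≤ᴸ⇒⊑ (s i) x si≤x)))

descent⇒∈D_R : (x : S (suc n)) (i : Fin n) → Descent x i → lookup (D_R x) i ≡ inside
descent⇒∈D_R x i desc = trans (lookup∘tabulate (λ i → ⌊ ℓ (x · s i) ℕ.<? ℓ x ⌋) i)
  (trans (isYes≗does (ℓ (x · s i) ℕ.<? ℓ x))
         (dec-true (ℓ (x · s i) ℕ.<? ℓ x) (descent⇒ℓ< x i desc)))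

∈D_R⇒descent : (x : S (suc n)) (i : Fin n) → lookup (D_R x) i ≡ inside → Descent x i
∈D_R⇒descent x i eq with trans (sym (lookup∘tabulate (λ i → ⌊ ℓ (x · s i) ℕ.<? ℓ x ⌋) i)) eq
... | yes≡ with ℓ (x · s i) ℕ.<? ℓ x
...   | yes ℓ< = ℓ<⇒descent x i ℓ<
...   | no _ with () ← yes≡

-- The upper bound.

-- Descents at all adjacent positions make `v` invert every pair, so `Between e x v` holds whatever
-- `x` is.
decreasing-maximum : (v : S (suc n)) → (∀ i → Descent v i) → ∀ x → δ e v ≡ δ e x + δ x v
decreasing-maximum v desc x = δ-between e x v λ a b a<b _ →
  adjacent⇒< {R = λ i j → v ⟨$⟩ʳ j Fin.< v ⟨$⟩ʳ i} (λ q r → ℕ.<-trans r q) desc a<b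

-- A common lower bound `z` would shorten the route from `y` to `x`: `δ y z + δ z x` is
-- `δ e y + δ e x` less twice `δ e z`. But `e` already lies on a geodesic from `y` to `x`.
antipodal-meet : (x y : S (suc n)) → (∀ i → Descent (x · y ⁻¹) i) → IsMeet x y e
antipodal-meet {n} x y desc = e≤ᴸ x , e≤ᴸ y , λ z z≤x z≤y →
  let δze≡0 = trans (δ-sym z e) (δez≡0 z (≤ᴸ⇒⊑ z x z≤x) (≤ᴸ⇒⊑ z y z≤y))
  in ≤ᴸ-respʳ-≈ z z e (δ≡0⇒≈ z e δze≡0) (≤ᴸ-refl z)
  where
  v : S (suc n)
  v = x · y ⁻¹

  -- Here `y ⁻¹` lies on a geodesic from `e` to `v`; translating by `y` puts `e` on one from `y` to
  -- `x`.
  geodesic : δ e y + δ e x ≡ δ y x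
  geodesic = begin
    δ e y + δ e x                  ≡⟨ cong₂ _+_ (δ-⁻¹ y) (δ-cong e e (v · y ⁻¹ ⁻¹) x
                                        (λ _ → refl) (λ k → cong (x ⟨$⟩ʳ_) (inverseˡ y))) ⟨
    δ e (y ⁻¹) + δ e (v · y ⁻¹ ⁻¹) ≡⟨ cong (δ e (y ⁻¹) +_) (δ-quotient (y ⁻¹) v) ⟩
    δ e (y ⁻¹) + δ (y ⁻¹) v        ≡⟨ decreasing-maximum v desc (y ⁻¹) ⟨
    δ e v                          ≡⟨ δ-quotient y x ⟩
    δ y x                          ∎
    where open ≡-Reasoning

  δez≡0 : ∀ z → z ⊑ x → z ⊑ y → δ e z ≡ 0
  -- One of the two copies of `δ e z` suffices for the cancellation; the other is added in the first
  -- step, so that both lower bound equations apply.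
  δez≡0 z z⊑x z⊑y = ℕ.n≤0⇒n≡0 (ℕ.+-cancelʳ-≤ (δ z y + δ z x) (δ e z) 0 (begin
    δ e z + (δ z y + δ z x)             ≤⟨ ℕ.+-monoʳ-≤ (δ e z) (ℕ.+-monoʳ-≤ (δ z y)
                                             (ℕ.m≤n+m (δ z x) (δ e z))) ⟩
    δ e z + (δ z y + (δ e z + δ z x))   ≡⟨ ℕ.+-assoc (δ e z) (δ z y) (δ e z + δ z x) ⟨
    δ e z + δ z y + (δ e z + δ z x)     ≡⟨ cong₂ _+_ z⊑y z⊑x ⟩
    δ e y + δ e x                       ≡⟨ geodesic ⟩
    δ y x                               ≤⟨ δ-triangle y z x ⟩
    δ y z + δ z x                       ≡⟨ cong (_+ δ z x) (δ-sym y z) ⟩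
    δ z y + δ z x                       ∎))
    where open ℕ.≤-Reasoning

descentCount≤ : {m : ℕ} (C : EssentialCongruence (suc (suc m))) → ∀ k → DescentCount C k → k ≤ m
descentCount≤ {m} C k (w , v , (p , (w~p , _) , v≈wp⁻¹) , ∣D∣≡k) =
  ℕ.≤-pred (ℕ.≤∧≢⇒< k≤1+m k≢1+m)
  where
  open EssentialCongruence C
  open IsSemilatticeCongruence isCongruence
  open IsEquivalence isEquivalence renaming (refl to ~-refl; sym to ~-sym; trans to ~-trans)

  k≤1+m : k ≤ suc m
  k≤1+m = subst (_≤ suc m) ∣D∣≡k (∣p∣≤n (D_R v))

  k≢1+m : k ≢ suc m
  -- Once `w · p ⁻¹ ≈ e`, the descent at the first generator reads 1 < 0.
  k≢1+m k≡1+m = ℕ.n≮0 (subst₂ Fin._<_ (wp⁻¹≈e (suc zero)) (wp⁻¹≈e zero) (desc zero))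
    where
    desc : ∀ i → Descent (w · p ⁻¹) i
    desc i = subst₂ Fin._<_ (v≈wp⁻¹ (suc i)) (v≈wp⁻¹ (inject₁ i)) (∈D_R⇒descent v i
      (trans (cong (λ D → lookup D i) (∣p∣≡n⇒p≡⊤ (trans ∣D∣≡k k≡1+m))) (lookup-replicate i inside)))

    e~p : e ~ p
    e~p = ∧-cong w~p ~-refl (antipodal-meet w p desc) (≤ᴸ-refl p , ≤ᴸ-refl p , λ _ z≤p _ → z≤p)

    p≈e : p ≈ e
    p≈e = isEssential p (~-sym e~p)

    w≈e : w ≈ e
    w≈e = isEssential w (~-trans w~p (~-sym e~p))

    wp⁻¹≈e : w · p ⁻¹ ≈ e
    wp⁻¹≈e i = trans (w≈e (p ⁻¹ ⟨$⟩ʳ i)) (trans (sym (p≈e (p ⁻¹ ⟨$⟩ʳ i))) (inverseʳ p))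

-- Congruences defined by test elements.

module _ {I : Set} (a : I → S (suc n)) where

  SameBelow : Rel (S (suc n)) 0ℓ
  SameBelow x y = ∀ i → (a i ≤ᴸ x → a i ≤ᴸ y) × (a i ≤ᴸ y → a i ≤ᴸ x)

  -- By the universal property an element is below a meet exactly when it is below both arguments.
  -- So the map from `x` to the set of `i` with `a i ≤ᴸ x` takes meets to intersections, and
  -- `SameBelow` is its kernel.
  sameBelow-isSemilatticeCongruence : IsSemilatticeCongruence SameBelow
  sameBelow-isSemilatticeCongruence = record
    { isEquivalence = record
      { refl  = λ i → (λ a≤x → a≤x) , (λ a≤x → a≤x)
      ; sym   = λ x~y i → proj₂ (x~y i) , proj₁ (x~y i)
      ; trans = λ x~y y~z i → proj₁ (y~z i) ∘ proj₁ (x~y i) , proj₂ (x~y i) ∘ proj₂ (y~z i)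
      }
    ; ≈⇒~    = λ {x} {y} x≈y i → ≤ᴸ-respʳ-≈ (a i) x y x≈y , ≤ᴸ-respʳ-≈ (a i) y x (sym ∘ x≈y)
    ; ∧-cong = λ {x₁} {x₂} {y₁} {y₂} {m₁} {m₂} x₁~x₂ y₁~y₂ meet₁ meet₂ i →
        below {x₁} {x₂} {y₁} {y₂} {m₁} {m₂} (a i) (proj₁ (x₁~x₂ i)) (proj₁ (y₁~y₂ i)) meet₁ meet₂
      , below {x₂} {x₁} {y₂} {y₁} {m₂} {m₁} (a i) (proj₂ (x₁~x₂ i)) (proj₂ (y₁~y₂ i)) meet₂ meet₁
    }
    where
    below : ∀ {x₁ x₂ y₁ y₂ m₁ m₂} (z : S (suc n)) → (z ≤ᴸ x₁ → z ≤ᴸ x₂) → (z ≤ᴸ y₁ → z ≤ᴸ y₂) →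
            IsMeet x₁ y₁ m₁ → IsMeet x₂ y₂ m₂ → z ≤ᴸ m₁ → z ≤ᴸ m₂
    below {x₁} {x₂} {y₁} {y₂} {m₁} {m₂} z x₁⇒x₂ y₁⇒y₂ (m₁≤x₁ , m₁≤y₁ , _) (_ , _ , greatest) z≤m₁ =
      greatest z (x₁⇒x₂ (≤ᴸ-trans z m₁ x₁ z≤m₁ m₁≤x₁)) (y₁⇒y₂ (≤ᴸ-trans z m₁ y₁ z≤m₁ m₁≤y₁))

atomsAnd : S (suc n) → Maybe (Fin n) → S (suc n)
atomsAnd p (just i) = s i
atomsAnd p nothing  = p

atomsAndCongruence : S (suc n) → EssentialCongruence (suc n)
atomsAndCongruence p = record
  { _~_          = SameBelow (atomsAnd p)
  ; isCongruence = sameBelow-isSemilatticeCongruence (atomsAnd p)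
  ; isEssential  = essential
  }
  where
  essential : IsEssential (SameBelow (atomsAnd p))
  essential x x~e with ≈e-or-descent x
  ... | inj₁ x≈e        = x≈e
  ... | inj₂ (i , desc) = contradiction
    (s≤ᴸ⇒descent e i (proj₁ (x~e (just i)) (descent⇒s≤ᴸ x i desc))) (ℕ.<⇒≯ (inject₁<suc i))

-- As `p` is itself a test element below `w`, every member of the class of `w` lies above `p`. The
-- two hypotheses put `p` in that class: each gives one direction for the atoms.
atomsAnd-minimal : (w p : S (suc n)) → p ≤ᴸ w → (∀ i → Descent w i → Descent p i) →
                   IsMinimalInClassOf (atomsAndCongruence p) w p
atomsAnd-minimal w p p≤w D⊆D = w~p , λ q w~q q≤p → ≤ᴸ-antisym q p q≤p (proj₁ (w~q nothing) p≤w)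
  where
  w~p : SameBelow (atomsAnd p) w p
  w~p (just i) = (λ si≤w → descent⇒s≤ᴸ p i (D⊆D i (s≤ᴸ⇒descent w i si≤w)))
               , (λ si≤p → ≤ᴸ-trans (s i) p w si≤p p≤w)
  w~p nothing  = (λ _ → ≤ᴸ-refl p) , (λ _ → p≤w)

-- Counting in nearly full subsets.

full-≤∣∣ : (D : Subset n) → (∀ i → lookup D i ≡ inside) → n ≤ ∣ D ∣
full-≤∣∣ []            all = z≤n
full-≤∣∣ (inside  ∷ D) all = s≤s (full-≤∣∣ D (all ∘ suc))
full-≤∣∣ (outside ∷ D) all with () ← all zero

-- The pairwise condition permits one gap at most: when the head is missing, the whole tail must be
-- present.
almostFull-≤∣∣ : (D : Subset (suc n)) →
                 (∀ i j → i Fin.< j → lookup D i ≡ inside ⊎ lookup D j ≡ inside) → n ≤ ∣ D ∣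
almostFull-≤∣∣ {zero}  D             pairs = z≤n
almostFull-≤∣∣ {suc n} (inside  ∷ D) pairs =
  s≤s (almostFull-≤∣∣ D λ i j i<j → pairs (suc i) (suc j) (s≤s i<j))
almostFull-≤∣∣ {suc n} (outside ∷ D) pairs = full-≤∣∣ D λ j → second j (pairs zero (suc j) (s≤s z≤n))
  where
  second : ∀ j → outside ≡ inside ⊎ lookup D j ≡ inside → lookup D j ≡ inside
  second j (inj₂ eq) = eq

-- Standardisation: permutations from injective keys.

injective⇒surjective : (f : Fin n → Fin n) → (∀ {a b} → f a ≡ f b → a ≡ b) →
                       ∀ j → ∃[ i ] f i ≡ j
injective⇒surjective {suc n} f inj j with any? (λ i → f i ≟ j)
... | yes hit  = hit
... | no  miss = contradiction
  (injective⇒≤ λ {a} {b} eq → inj (punchOut-injective (avoids a) (avoids b) eq)) ℕ.1+n≰n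
  where
  avoids : ∀ i → j ≢ f i
  avoids i j≡fi = miss (i , sym j≡fi)

module Standardisation (κ : Fin n → ℕ) (κ-injective : ∀ {a b} → κ a ≡ κ b → a ≡ b) where

  rank : Fin n → ℕ
  rank a = sum λ c → χ (κ c) (κ a)

  χ-irrefl : ∀ k → χ k k ≡ 0
  χ-irrefl k = χ-≮ (ℕ.<-irrefl {k} refl)

  rank<n : ∀ a → rank a < n
  rank<n a = subst (rank a <_) sum-1≡n
    -- The comparison is with the constant 1, whose sum is `n`. It is strict at `c = a`, since no
    -- key is below itself.
    (sum-mono-< (λ c → χ≤1 (κ c) (κ a)) a (subst (_< 1) (sym (χ-irrefl (κ a))) (s≤s z≤n)))
    where
    χ≤1 : ∀ k l → χ k l ≤ 1
    χ≤1 k l with k ℕ.<? l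
    ... | yes k<l = ℕ.≤-reflexive (χ-< k<l)
    ... | no  k≮l = subst (_≤ 1) (sym (χ-≮ k≮l)) z≤n

    sum-1≡n : ∀ {n} → sum {n} (λ _ → 1) ≡ n
    sum-1≡n {zero}  = refl
    sum-1≡n {suc n} = cong suc sum-1≡n

  rank-mono : ∀ {a b} → κ a < κ b → rank a < rank b
  -- Strict at `c = a`, which counts towards the rank of `b` but not towards its own.
  rank-mono {a} {b} κa<κb = sum-mono-< ≤-pointwise a
    (subst₂ _<_ (sym (χ-irrefl (κ a))) (sym (χ-< κa<κb)) (s≤s z≤n))
    where
    ≤-pointwise : ∀ c → χ (κ c) (κ a) ≤ χ (κ c) (κ b)
    ≤-pointwise c with κ c ℕ.<? κ a
    ... | yes κc<κa = ℕ.≤-reflexive (trans (χ-< κc<κa) (sym (χ-< (ℕ.<-trans κc<κa κa<κb))))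
    ... | no  κc≮κa = subst (_≤ χ (κ c) (κ b)) (sym (χ-≮ κc≮κa)) z≤n

  rankFin : Fin n → Fin n
  rankFin a = fromℕ< (rank<n a)

  rankFin-mono : ∀ {a b} → κ a < κ b → rankFin a Fin.< rankFin b
  rankFin-mono κa<κb = subst₂ _<_ (sym (toℕ-fromℕ< _)) (sym (toℕ-fromℕ< _)) (rank-mono κa<κb)

  rankFin-injective : ∀ {a b} → rankFin a ≡ rankFin b → a ≡ b
  rankFin-injective {a} {b} eq with ℕ.<-cmp (κ a) (κ b)
  ... | tri< lt _ _  = contradiction (rankFin-mono lt) (ℕ.<-irrefl (cong toℕ eq))
  ... | tri≈ _ κ≡ _  = κ-injective κ≡
  ... | tri> _ _ gt  = contradiction (rankFin-mono gt) (ℕ.<-irrefl (cong toℕ (sym eq)))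

  abstract
    -- Abstract, so that later arguments compare keys through `std-mono` and `std-cancel` and never
    -- compute ranks.
    std : S n
    std = permutation rankFin (proj₁ ∘ preimage) (proj₂ ∘ preimage)
      (λ a → rankFin-injective (proj₂ (preimage (rankFin a))))
      where
      preimage : ∀ j → ∃[ i ] rankFin i ≡ j
      preimage = injective⇒surjective rankFin rankFin-injective

    std-mono : ∀ {a b} → κ a < κ b → std ⟨$⟩ʳ a Fin.< std ⟨$⟩ʳ b
    std-mono = rankFin-mono

    std-cancel : ∀ {a b} → std ⟨$⟩ʳ a Fin.< std ⟨$⟩ʳ b → κ a < κ b
    std-cancel {a} {b} lt with ℕ.<-cmp (κ a) (κ b)
    ... | tri< κ< _ _ = κ<
    ... | tri≈ _ κ≡ _ = contradiction lt (ℕ.<-irrefl (cong (toℕ ∘ rankFin) (κ-injective κ≡)))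
    ... | tri> _ _ κ> = contradiction lt (ℕ.<⇒≯ (std-mono κ>))

-- Ordering positions by parity.

opposite-mono : {a b : Fin n} → a Fin.< b → opposite b Fin.< opposite a
opposite-mono {a = a} {b} a<b rewrite opposite-prop a | opposite-prop b =
  ℕ.∸-monoʳ-< (s≤s a<b) (toℕ<n b)

opposite-injective : {a b : Fin n} → opposite a ≡ opposite b → a ≡ b
opposite-injective {a = a} {b} eq =
  trans (sym (opposite-involutive a)) (trans (cong opposite eq) (opposite-involutive b))

odd : ℕ → Bool
odd zero    = false
odd (suc k) = not (odd k)

parity-cases : ∀ k l → odd k ≢ odd l →
               (odd k ≡ false × odd l ≡ true) ⊎ (odd k ≡ true × odd l ≡ false)
parity-cases k l differ with odd k | odd l
... | false | true  = inj₁ (refl , refl)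
... | true  | false = inj₂ (refl , refl)
... | false | false = contradiction refl differ
... | true  | true  = contradiction refl differ

module ParityOrder (f : Fin n → Fin n) (f-injective : ∀ {a b} → f a ≡ f b → a ≡ b) where

  -- The lexicographic order by parity and then by `f`, packed into one number: values of `f` are
  -- below `n`, so the offset `n` keeps the two classes apart.
  key : Fin n → ℕ
  key a = (if odd (toℕ a) then n else 0) + toℕ (f a)

  key-even<odd : ∀ a b → odd (toℕ a) ≡ false → odd (toℕ b) ≡ true → key a < key b
  key-even<odd a b even-a odd-b rewrite even-a | odd-b =
    ℕ.<-≤-trans (toℕ<n (f a)) (ℕ.m≤m+n n (toℕ (f b)))

  key-sameParity : ∀ a b → odd (toℕ a) ≡ odd (toℕ b) → f a Fin.< f b → key a < key b
  key-sameParity a b same fa<fb rewrite same = ℕ.+-monoʳ-< (if odd (toℕ b) then n else 0) fa<fb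

  key-injective : ∀ {a b} → key a ≡ key b → a ≡ b
  key-injective {a} {b} key≡ with <-cmp (f a) (f b) | odd (toℕ a) Bool.≟ odd (toℕ b)
  ... | tri≈ _ fa≡fb _ | _        = f-injective fa≡fb
  ... | tri< lt _ _    | yes same = contradiction (key-sameParity a b same lt) (ℕ.<-irrefl key≡)
  ... | tri> _ _ gt    | yes same = contradiction (key-sameParity b a (sym same) gt)
                                           (ℕ.<-irrefl (sym key≡))
  ... | _              | no differ with parity-cases (toℕ a) (toℕ b) differ
  ...   | inj₁ (even-a , odd-b) = contradiction (key-even<odd a b even-a odd-b) (ℕ.<-irrefl key≡)
  ...   | inj₂ (odd-a , even-b) = contradiction (key-even<odd b a even-b odd-a)
                                          (ℕ.<-irrefl (sym key≡))

  open Standardisation key key-injective public using (std; std-mono; std-cancel)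

-- The extremal pair of permutations.

module _ {m : ℕ} where

  private
    module P = ParityOrder {suc m} (λ a → a) (λ eq → eq)
    module W = ParityOrder {suc m} opposite opposite-injective

  -- Sending the even positions (counted from 0) to the small values gives the one-line
  -- notations p = 1 (k+1) 2 (k+2) ⋯ and w = k n (k−1) (n−1) ⋯, with n = m + 1.
  p w : S (suc m)
  p = P.std
  w = W.std

  -- Inclusion of inversions: `w` inverts all pairs of equal parity, and pairs of mixed parity are
  -- ordered alike by `p` and `w`, with even positions getting the smaller values.
  p≤w : p ≤ᴸ w
  p≤w = between⇒≤ᴸ p w λ a b a<b pb<pa → W.std-mono (keys a b a<b (P.std-cancel pb<pa))
    where
    keys : ∀ a b → a Fin.< b → P.key b < P.key a → W.key b < W.key a
    keys a b a<b b≺a with odd (toℕ a) Bool.≟ odd (toℕ b)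
    ... | yes same = W.key-sameParity b a (sym same) (opposite-mono a<b)
    ... | no differ with parity-cases (toℕ a) (toℕ b) differ
    ...   | inj₁ (even-a , odd-b) = contradiction b≺a (ℕ.<⇒≯ (P.key-even<odd a b even-a odd-b))
    ...   | inj₂ (odd-a , even-b) = W.key-even<odd b a even-b odd-a

  -- Adjacent positions differ in parity, so parity alone decides the comparison in both
  -- permutations.
  descents-w⊆p : ∀ i → Descent w i → Descent p i
  descents-w⊆p i desc = keys (odd (toℕ (inject₁ i))) refl
    where
    odd-suc : odd (toℕ (suc i)) ≡ not (odd (toℕ (inject₁ i)))
    odd-suc = cong (not ∘ odd) (sym (toℕ-inject₁ i))

    keys : ∀ o → odd (toℕ (inject₁ i)) ≡ o → Descent p i
    keys true  odd-i  =
      P.std-mono (P.key-even<odd (suc i) (inject₁ i) (trans odd-suc (cong not odd-i)) odd-i)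
    keys false even-i = contradiction desc
      (ℕ.<⇒≯ (W.std-mono (W.key-even<odd (inject₁ i) (suc i) even-i
                                         (trans odd-suc (cong not even-i)))))

  p⁻¹-key-mono : ∀ {c d} → c Fin.< d → P.key (p ⁻¹ ⟨$⟩ʳ c) < P.key (p ⁻¹ ⟨$⟩ʳ d)
  p⁻¹-key-mono c<d = P.std-cancel (subst₂ Fin._<_ (sym (inverseʳ p)) (sym (inverseʳ p)) c<d)

  -- The positions compared are consecutive in the order of `P.key`. Within one parity class `p`
  -- increases and `w` decreases, which gives a descent; the only other case is the passage from the
  -- even class to the odd one.
  wp⁻¹-descent : ∀ i → Descent (w · p ⁻¹) i ⊎
    (odd (toℕ (p ⁻¹ ⟨$⟩ʳ inject₁ i)) ≡ false × odd (toℕ (p ⁻¹ ⟨$⟩ʳ suc i)) ≡ true)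
  wp⁻¹-descent i = cases (p ⁻¹ ⟨$⟩ʳ inject₁ i) (p ⁻¹ ⟨$⟩ʳ suc i) (p⁻¹-key-mono (inject₁<suc i))
    where
    cases : ∀ a b → P.key a < P.key b →
            (w ⟨$⟩ʳ b Fin.< w ⟨$⟩ʳ a) ⊎ (odd (toℕ a) ≡ false × odd (toℕ b) ≡ true)
    cases a b a≺b with odd (toℕ a) Bool.≟ odd (toℕ b)
    ... | no differ with parity-cases (toℕ a) (toℕ b) differ
    ...   | inj₁ even-odd         = inj₂ even-odd
    ...   | inj₂ (odd-a , even-b) = contradiction a≺b (ℕ.<⇒≯ (P.key-even<odd b a even-b odd-a))
    cases a b a≺b | yes same with <-cmp a b
    ... | tri< a<b _ _  = inj₁ (W.std-mono (W.key-sameParity b a (sym same) (opposite-mono a<b)))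
    ... | tri≈ _ refl _ = contradiction a≺b (ℕ.<-irrefl refl)
    ... | tri> _ _ b<a  = contradiction a≺b (ℕ.<⇒≯ (P.key-sameParity b a (sym same) b<a))

  -- p ⁻¹ lists the even positions before the odd ones, so the exceptional case of
  -- wp⁻¹-descent occurs at most once.
  wp⁻¹-descents : ∀ i j → i Fin.< j → Descent (w · p ⁻¹) i ⊎ Descent (w · p ⁻¹) j
  wp⁻¹-descents i j i<j with wp⁻¹-descent i | wp⁻¹-descent j
  ... | inj₁ desc | _         = inj₁ desc
  ... | inj₂ _    | inj₁ desc = inj₂ desc
  ... | inj₂ (_ , odd-b) | inj₂ (even-a , _) = contradiction
    (p-mono (P.key-even<odd (p ⁻¹ ⟨$⟩ʳ inject₁ j) (p ⁻¹ ⟨$⟩ʳ suc i) even-a odd-b))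
    (ℕ.≤⇒≯ (ℕ.≤-trans i<j (ℕ.≤-reflexive (sym (toℕ-inject₁ j)))))
    where
    p-mono : ∀ {c d} → P.key (p ⁻¹ ⟨$⟩ʳ c) < P.key (p ⁻¹ ⟨$⟩ʳ d) → c Fin.< d
    p-mono lt = subst₂ Fin._<_ (inverseʳ p) (inverseʳ p) (P.std-mono lt)

theorem5p2 : (n : ℕ) → 2 ≤ n →
    IsMaximumOf
    (λ k → Σ[ C ∈ EssentialCongruence n ] IsMaximumOf (DescentCount C) k)
    (n ∸ 2)
theorem5p2 (suc (suc m)) (s≤s (s≤s z≤n)) =
  -- The same bound serves both maxima, the one within `C` and the one over all congruences.
  (C , attained , descentCount≤ C) , λ k (C′ , count , _) → descentCount≤ C′ k count
  where
  C : EssentialCongruence (suc (suc m))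
  C = atomsAndCongruence p

  v : S (suc (suc m))
  v = w · p ⁻¹

  attained : DescentCount C m
  attained = w , v , sorts , ℕ.≤-antisym (descentCount≤ C ∣ D_R v ∣ (w , v , sorts , refl)) many
    where
    sorts : StackSorts C w v
    sorts = p , atomsAnd-minimal w p p≤w descents-w⊆p , λ _ → refl

    many : m ≤ ∣ D_R v ∣
    many = almostFull-≤∣∣ (D_R v) λ i j i<j →
      Sum⊎.map (descent⇒∈D_R v i) (descent⇒∈D_R v j) (wp⁻¹-descents i j i<j)
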